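{- Let $k \geq 3$ and $n \ge 2k$ be integers. Let $k' = \lfloor k/2 \rfloor$ (so $k = 2k'$ or $k = 2k'+1$), $T = 4k'+1$, $m = \lfloor n/T \rfloor$ and $\bar r = n \bmod T$. Then $$\gamma_{md}(P(n,k)) \leq \begin{cases} (3k'+1)m + \bar r & \text{if } \bar r \text{ is even},\\ (3k'+1)m + k' + \frac{\bar r + 1}{2} & \text{if } \bar r \text{ is odd}.\end{cases}$$
   Context: For integers $n$ and $k$ with $1 \le k \le n/2$, the generalized Petersen graph $P(n,k)$ has vertex set $\{v_i, u_i : 0 \le i \le n-1\}$ and edge set $\{v_i v_{(i+1) \bmod n},\ v_i u_i,\ u_i u_{(i+k) \bmod n} : 0 \le i \le n-1\}$. For a graph $G=(V,E)$, a set $S \subseteq V \cup E$ is a mixed dominating set if every element of $(V \cup E)\setminus S$ is adjacent or incident to some element of $S$ (vertices are adjacent if joined by an edge, edges are adjacent if they share an endpoint, and a vertex and an edge are incident if the vertex is an endpoint of the edge). The mixed domination number $\gamma_{md}(G)$ is the minimum size of a mixed dominating set of $G$. -}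

module Defs where

open import Data.Nat using (ℕ; suc; _+_; _*_; _≤_)
open import Data.Nat.DivMod using (_/_; _%_)
open import Data.Fin using (Fin; toℕ)
open import Data.List using (List; length)
open import Data.List.Relation.Unary.Any using (Any)
open import Data.Product using (_×_; ∃)
open import Data.Sum using (_⊎_)
open import Relation.Binary.PropositionalEquality using (_≡_)

data Vtx (n : ℕ) : Set where
  outer : Fin n → Vtx n
  inner : Fin n → Vtx n

-- j ≡ (i + d) mod n, for i, j < n and d ≤ n  (written without _%_)
AddMod : (n d : ℕ) → Fin n → Fin n → Set
AddMod n d i j = (toℕ i + d ≡ toℕ j) ⊎ (toℕ i + d ≡ toℕ j + n)

data Adj (n k : ℕ) : Vtx n → Vtx n → Set where
  rim    : ∀ {i j} → AddMod n 1 i j → Adj n k (outer i) (outer j)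
  rim'   : ∀ {i j} → AddMod n 1 j i → Adj n k (outer i) (outer j)
  spoke  : ∀ {i} → Adj n k (outer i) (inner i)
  spoke' : ∀ {i} → Adj n k (inner i) (outer i)
  inn    : ∀ {i j} → AddMod n k i j → Adj n k (inner i) (inner j)
  inn'   : ∀ {i j} → AddMod n k j i → Adj n k (inner i) (inner j)

-- Elements of V ∪ E.  An edge is represented by an ordered pair of its
-- endpoints; the two orientations denote the same edge (see SameElem).
data Elem (n k : ℕ) : Set where
  vx : Vtx n → Elem n k
  ed : (x y : Vtx n) → Adj n k x y → Elem n k

data SameElem {n k : ℕ} : Elem n k → Elem n k → Set where
  sameV : ∀ {a} → SameElem (vx a) (vx a)
  sameE : ∀ {x y p q} → SameElem (ed x y p) (ed x y q)
  flipE : ∀ {x y p q} → SameElem (ed x y p) (ed y x q)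

data Endpoint {n k : ℕ} (a : Vtx n) : Elem n k → Set where
  left  : ∀ {y p} → Endpoint a (ed a y p)
  right : ∀ {x p} → Endpoint a (ed x a p)

Dom : {n k : ℕ} → Elem n k → Elem n k → Set
Dom {n} {k} (vx a) (vx b)     = Adj n k a b
Dom (vx a) e@(ed _ _ _)       = Endpoint a e
Dom s@(ed _ _ _) (vx a)       = Endpoint a s
Dom s@(ed _ _ _) e@(ed _ _ _) = ∃ λ a → Endpoint a s × Endpoint a e

IsMixedDominating : (n k : ℕ) → List (Elem n k) → Set
IsMixedDominating n k S =
  (e : Elem n k) → Any (SameElem e) S ⊎ Any (λ s → Dom s e) S

γmd≤ : (n k b : ℕ) → Set
γmd≤ n k b = ∃ λ (S : List (Elem n k)) → IsMixedDominating n k S × length S ≤ b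

bound : (n k : ℕ) → ℕ
bound n k with n % suc (4 * (k / 2)) % 2
... | 0 = (3 * (k / 2) + 1) * (n / suc (4 * (k / 2))) + n % suc (4 * (k / 2))
... | _ = (3 * (k / 2) + 1) * (n / suc (4 * (k / 2))) + k / 2
          + (n % suc (4 * (k / 2)) + 1) / 2

{-# OPTIONS --safe #-}

-- Write k = 2h or 2h + 1; call {vᵢ, uᵢ} column i.  A set containing inner vertices,
-- rim edges, spokes and inner edges is mixed dominating as soon as every edge has an
-- endpoint touched by the set and every untouched vertex has a neighbour in it.
--
-- A standard block has 2a + 1 columns containing alternately uᵢ and the spoke vᵢuᵢ,
-- followed by 2s columns paired by s rim edges; it has 2a + 1 + s elements.  Only the
-- inner vertices of the paired columns need care: if 2s ≤ k ≤ 2a + 1, then for each of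
-- them one of the two columns at distance k, in this block or at the start of the next
-- one, contains its inner vertex.  So such blocks can be put around the graph in any
-- order.  The block with a = s = h has length T and 3h + 1 elements.
--
-- An even remainder r is absorbed by a = h + r / 2 in one block.  If r = 1 + 2ρ with
-- ρ ≥ 2, one block of length T and the remainder are replaced by two blocks with a = h
-- and s-values summing to ρ; if r = 1, two blocks of length T and the remainder become
-- one block with a = 3h + 1.  If r = 3, a block of length T + 3 of a different shape is
-- needed.  When no block of length T can be spared, all n spokes are few enough.

module Submission where

open import Defs
open import Data.Nat using (ℕ; _≤_; _*_)
open import Data.Nat using (zero; suc; _+_; _<_; _∸_; NonZero; >-nonZero; s≤s; s≤s⁻¹; z≤n; z<s; s<s)
open import Data.Nat.DivMod
  using (_/_; _%_; _mod_; m≡m%n+[m/n]*n; m<n⇒m%n≡m; m%n<n; [m+n]%n≡m%n; [m+kn]%n≡m%n;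
         m*n%n≡0; m*n/n≡m)
open import Data.Nat.Properties
open import Data.Nat.Tactic.RingSolver using (solve-∀)
open import Data.Fin using (Fin; toℕ)
open import Data.Fin.Properties using (toℕ-injective; toℕ-fromℕ<; toℕ<n)
open import Data.List using (List; []; _∷_; _++_; map; length; applyUpTo; replicate)
open import Data.List.Properties using (length-++; length-map; length-applyUpTo)
open import Data.List.Membership.Propositional using (_∈_; find; lose)
open import Data.List.Membership.Propositional.Properties
  using (∈-++⁺ˡ; ∈-++⁺ʳ; ∈-map⁺; ∈-applyUpTo⁺)
open import Data.List.Relation.Unary.Any using (Any; here; there)
open import Data.Product using (_×_; _,_; ∃; proj₁; proj₂)
open import Data.Sum using (_⊎_; inj₁; inj₂; [_,_]′; swap)
open import Function using (_∘_; id)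
open import Relation.Nullary using (¬_; contradiction; yes; no)
open import Relation.Binary.PropositionalEquality
  using (_≡_; refl; sym; trans; cong; cong₂; subst; subst₂)

-- Domination reduced to touched vertices.

Touched : ∀ {n k} → List (Elem n k) → Vtx n → Set
Touched S x = Any (λ s → s ≡ vx x ⊎ Endpoint x s) S

adj-sym : ∀ {n k x y} → Adj n k x y → Adj n k y x
adj-sym (rim p)  = rim' p
adj-sym (rim' p) = rim p
adj-sym spoke    = spoke'
adj-sym spoke'   = spoke
adj-sym (inn p)  = inn' p
adj-sym (inn' p) = inn p

module _ {n k : ℕ} (S : List (Elem n k)) where

  private
    onVertex : ∀ {x} → Touched S x → Any (SameElem (vx x)) S ⊎ Any (λ s → Dom s (vx x)) S
    onVertex t with find t
    ... | _ , s∈S , inj₁ refl = inj₁ (lose s∈S sameV)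
    ... | ed _ _ _ , s∈S , inj₂ ep = inj₂ (lose s∈S ep)

    onEdge : ∀ {x y z p} → Endpoint {n} {k} z (ed x y p) → Touched S z →
             Any (λ s → Dom s (ed x y p)) S
    onEdge ez t with find t
    ... | _ , s∈S , inj₁ refl = lose s∈S ez
    ... | ed _ _ _ , s∈S , inj₂ ep = lose s∈S (_ , ep , ez)

  -- Whatever touches `x`, be it `x` itself or an edge at `x`, dominates every edge at `x`. Under
  -- `Dom` an edge dominates itself, so edges in `S` need no separate treatment.
  touched⇒dominating :
    (∀ x → Touched S x ⊎ ∃ λ y → vx y ∈ S × Adj n k y x) →
    (∀ {x y} → Adj n k x y → Touched S x ⊎ Touched S y) →
    IsMixedDominating n k S
  touched⇒dominating vs es (vx x) with vs x
  ... | inj₁ t = onVertex t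
  ... | inj₂ (y , y∈S , a) = inj₂ (lose y∈S a)
  touched⇒dominating vs es (ed x y p) with es p
  ... | inj₁ t = inj₂ (onEdge left t)
  ... | inj₂ t = inj₂ (onEdge right t)

-- Column indices modulo n.

module _ {n : ℕ} .{{_ : NonZero n}} where

  toℕ-mod : ∀ i → toℕ (i mod n) ≡ i % n
  toℕ-mod i = toℕ-fromℕ< (m%n<n i n)

  mod-cong : ∀ {i j} → i % n ≡ j % n → i mod n ≡ j mod n
  mod-cong {i} {j} eq = toℕ-injective (trans (toℕ-mod i) (trans eq (sym (toℕ-mod j))))

  toℕ-mod-inverse : (f : Fin n) → toℕ f mod n ≡ f
  toℕ-mod-inverse f = toℕ-injective (trans (toℕ-mod _) (m<n⇒m%n≡m (toℕ<n f)))

  n+i-mod : ∀ i → (n + i) mod n ≡ i mod n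
  n+i-mod i = mod-cong (trans (cong (_% n) (+-comm n i)) ([m+n]%n≡m%n i n))

  addMod⇒mod : ∀ {d} {f g : Fin n} → AddMod n d f g → (toℕ f + d) mod n ≡ g
  addMod⇒mod {g = g} (inj₁ p) = trans (cong (_mod n) p) (toℕ-mod-inverse g)
  addMod⇒mod {g = g} (inj₂ p) =
    trans (cong (_mod n) p)
      (trans (mod-cong ([m+n]%n≡m%n (toℕ g) n)) (toℕ-mod-inverse g))

  mod⇒addMod : ∀ {d} → d ≤ n → ∀ i → AddMod n d (i mod n) ((i + d) mod n)
  mod⇒addMod {d} d≤n i = subst₂ (λ a b → a + d ≡ b ⊎ a + d ≡ b + n)
      (sym (toℕ-mod i)) (sym (toℕ-mod (i + d))) step
    where
    shift : (i + d) % n ≡ (i % n + d) % n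
    shift = trans (cong (_% n) (trans (cong (_+ d) (m≡m%n+[m/n]*n i n))
              (exchange (i % n) (i / n * n) d)))
              ([m+kn]%n≡m%n (i % n + d) (i / n) n)
      where exchange : ∀ a b c → a + b + c ≡ a + c + b
            exchange = solve-∀
    step : i % n + d ≡ (i + d) % n ⊎ i % n + d ≡ (i + d) % n + n
    step with i % n + d <? n
    ... | yes lt = inj₁ (sym (trans shift (m<n⇒m%n≡m lt)))
    ... | no ≮n = inj₂ (sym (trans (cong (_+ n) reduced) (m∸n+n≡m n≤)))
      where
      n≤ : n ≤ i % n + d
      n≤ = ≮⇒≥ ≮n
      -- Since `d ≤ n`, the sum is below 2n, so one subtraction of n reduces it.
      small : i % n + d ∸ n < n
      small = +-cancelʳ-< n _ _ (subst (_< n + n) (sym (m∸n+n≡m n≤))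
                (+-mono-<-≤ (m%n<n i n) d≤n))
      reduced : (i + d) % n ≡ i % n + d ∸ n
      reduced = trans shift (trans (cong (_% n) (sym (m∸n+n≡m n≤)))
                  (trans ([m+n]%n≡m%n _ n) (m<n⇒m%n≡m small)))

-- Patterns and blocks.

-- At position i: the vertex uᵢ and the edges vᵢuᵢ, vᵢvᵢ₊₁ and uᵢuᵢ₊ₖ.
data Kind : Set where
  innerV spokeE rimE innE : Kind

Pattern : Set
Pattern = List (Kind × ℕ)

-- Touching by elements of the pattern itself; contributions of other blocks are ignored, so the
-- property survives any placement.
data OuterCov (Γ : Pattern) : ℕ → Set where
  bySpoke : ∀ {e} → (spokeE , e) ∈ Γ → OuterCov Γ e
  byRimˡ  : ∀ {e} → (rimE , e) ∈ Γ → OuterCov Γ e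
  byRimʳ  : ∀ {e} → (rimE , e) ∈ Γ → OuterCov Γ (e + 1)

data InnerCov (k : ℕ) (Γ : Pattern) : ℕ → Set where
  byVertex : ∀ {e} → (innerV , e) ∈ Γ → InnerCov k Γ e
  bySpoke  : ∀ {e} → (spokeE , e) ∈ Γ → InnerCov k Γ e
  byInnˡ   : ∀ {e} → (innE , e) ∈ Γ → InnerCov k Γ e
  byInnʳ   : ∀ {e} → (innE , e) ∈ Γ → InnerCov k Γ (e + k)

-- How an untouched inner vertex e of a block of length ℓ is dominated, with the inner edge
-- from e to e + k having its other end touched.  Columns from ℓ on are columns of the next
-- block, about which only the entry conditions of Block are known.
data Exposed (k h ℓ : ℕ) (Γ : Pattern) (e : ℕ) : Set where
  behind : ∀ d → e ≡ d + k → (innerV , d) ∈ Γ → InnerCov k Γ (e + k) → Exposed k h ℓ Γ e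
  ahead  : (innerV , e + k) ∈ Γ → Exposed k h ℓ Γ e
  across-behind : ∀ d e′ → e ≡ d + k → (innerV , d) ∈ Γ →
                  e + k ≡ ℓ + e′ → k ≤ e′ + 2 * h → Exposed k h ℓ Γ e
  across-ahead  : ∀ j → e + k ≡ ℓ + 2 * j → k ≤ 2 * j + 2 * h → Exposed k h ℓ Γ e

-- The entry conditions say what a block offers to the block before it; columns e < k − 2h
-- are exempt because a block has at most 2h trailing columns with untouched inner vertex.
record Block (k h : ℕ) : Set where
  field
    size  : ℕ
    cells : Pattern
    outer-valid : ∀ e → e < size → OuterCov cells e ⊎
                    ((innerV , e) ∈ cells × OuterCov cells (e + 1))
    inner-valid : ∀ e → e < size → InnerCov k cells e ⊎ Exposed k h size cells e
    entry-touched : ∀ e → e < k → k ≤ e + 2 * h → InnerCov k cells e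
    entry-vertex  : ∀ j → 2 * j < k → k ≤ 2 * j + 2 * h → (innerV , 2 * j) ∈ cells
  cost : ℕ
  cost = length cells

open Block

module _ {k h : ℕ} where

  totalSize totalCost : List (Block k h) → ℕ
  totalSize []       = 0
  totalSize (B ∷ Bs) = size B + totalSize Bs
  totalCost []       = 0
  totalCost (B ∷ Bs) = cost B + totalCost Bs

  totalSize-replicate : ∀ q B → totalSize (replicate q B) ≡ q * size B
  totalSize-replicate zero    B = refl
  totalSize-replicate (suc q) B = cong (size B +_) (totalSize-replicate q B)

  totalCost-replicate : ∀ q B → totalCost (replicate q B) ≡ q * cost B
  totalCost-replicate zero    B = refl
  totalCost-replicate (suc q) B = cong (cost B +_) (totalCost-replicate q B)

-- Laying blocks around the graph.

module Wheel {n k : ℕ} .{{_ : NonZero n}} (1≤n : 1 ≤ n) (k≤n : k ≤ n) where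

  elem : Kind × ℕ → Elem n k
  elem (innerV , i) = vx (inner (i mod n))
  elem (spokeE , i) = ed (outer (i mod n)) (inner (i mod n)) spoke
  elem (rimE   , i) = ed (outer (i mod n)) (outer ((i + 1) mod n)) (rim (mod⇒addMod 1≤n i))
  elem (innE   , i) = ed (inner (i mod n)) (inner ((i + k) mod n)) (inn (mod⇒addMod k≤n i))

  module Positions (S : List (Elem n k)) where

    TV TU DU : ℕ → Set
    TV i = Touched S (outer (i mod n))
    TU i = Touched S (inner (i mod n))
    DU i = vx (inner (i mod n)) ∈ S

    DU⇒TU : ∀ {i} → DU i → TU i
    DU⇒TU p = lose p (inj₁ refl)

    -- Each position answers for its two vertices, its spoke and its forward edges, those to columns
    -- i + 1 and i + k. Backward edges are answered for at their other end, so only the forward end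
    -- of an untouched vertex has to be touched.
    OuterOK InnerOK : ℕ → Set
    OuterOK i = TV i ⊎ (DU i × TV (i + 1))
    InnerOK i = TU i ⊎ (TU (i + k) × (DU (i + k) ⊎ ∃ λ d → i ≡ d + k × DU d))

    positions⇒dominating : (∀ i → i < n → OuterOK i × InnerOK i) → IsMixedDominating n k S
    positions⇒dominating ok = touched⇒dominating S vs es
      where
      onFin : (P : Fin n → Set) (f : Fin n) → P (toℕ f mod n) → P f
      onFin P f = subst P (toℕ-mod-inverse f)

      outerOK : ∀ f → OuterOK (toℕ f)
      outerOK f = proj₁ (ok (toℕ f) (toℕ<n f))
      innerOK : ∀ f → InnerOK (toℕ f)
      innerOK f = proj₂ (ok (toℕ f) (toℕ<n f))

      vs : ∀ x → Touched S x ⊎ ∃ λ y → vx y ∈ S × Adj n k y x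
      vs (outer f) with outerOK f
      ... | inj₁ t = inj₁ (onFin (Touched S ∘ outer) f t)
      ... | inj₂ (d , _) = inj₂ (inner f , onFin (λ g → vx (inner g) ∈ S) f d , spoke')
      vs (inner f) with innerOK f
      ... | inj₁ t = inj₁ (onFin (Touched S ∘ inner) f t)
      ... | inj₂ (_ , inj₁ d) =
        inj₂ (_ , d , inn' (onFin (λ g → AddMod n k g ((toℕ f + k) mod n)) f
                             (mod⇒addMod k≤n (toℕ f))))
      ... | inj₂ (_ , inj₂ (d , eq , d∈S)) =
        inj₂ (_ , d∈S , inn (subst (AddMod n k (d mod n))
                  (trans (cong (_mod n) (sym eq)) (toℕ-mod-inverse f)) (mod⇒addMod k≤n d)))

      rims : ∀ {f g} → AddMod n 1 f g → Touched S (outer f) ⊎ Touched S (outer g)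
      rims {f} {g} p with outerOK f
      ... | inj₁ t = inj₁ (onFin (Touched S ∘ outer) f t)
      ... | inj₂ (_ , t) = inj₂ (subst (Touched S ∘ outer) (addMod⇒mod {f = f} p) t)

      inns : ∀ {f g} → AddMod n k f g → Touched S (inner f) ⊎ Touched S (inner g)
      inns {f} {g} p with innerOK f
      ... | inj₁ t = inj₁ (onFin (Touched S ∘ inner) f t)
      ... | inj₂ (t , _) = inj₂ (subst (Touched S ∘ inner) (addMod⇒mod {f = f} p) t)

      spokes : ∀ f → Touched S (outer f) ⊎ Touched S (inner f)
      spokes f with outerOK f
      ... | inj₁ t = inj₁ (onFin (Touched S ∘ outer) f t)
      ... | inj₂ (d , _) = inj₂ (onFin (Touched S ∘ inner) f (DU⇒TU d))

      es : ∀ {x y} → Adj n k x y → Touched S x ⊎ Touched S y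
      es (rim p)  = rims p
      es (rim' p) = swap (rims p)
      es spoke    = spokes _
      es spoke'   = swap (spokes _)
      es (inn p)  = inns p
      es (inn' p) = swap (inns p)

  allSpokes : γmd≤ n k n
  allSpokes = S , positions⇒dominating ok , ≤-reflexive (length-applyUpTo spoke′ n)
    where
    spoke′ : ℕ → Elem n k
    spoke′ i = elem (spokeE , i)
    S : List (Elem n k)
    S = applyUpTo spoke′ n
    open Positions S
    ok : ∀ i → i < n → OuterOK i × InnerOK i
    ok i i<n = inj₁ (lose i∈S (inj₂ left)) , inj₁ (lose i∈S (inj₂ right))
      where i∈S = ∈-applyUpTo⁺ spoke′ i<n

  module _ {h : ℕ} where

    at : ℕ → Kind × ℕ → Elem n k
    at c (κ , e) = elem (κ , c + e)

    layout : ℕ → List (Block k h) → List (Elem n k)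
    layout c []       = []
    layout c (B ∷ Bs) = map (at c) (cells B) ++ layout (c + size B) Bs

    length-layout : ∀ c Bs → length (layout c Bs) ≡ totalCost Bs
    length-layout c []       = refl
    length-layout c (B ∷ Bs) =
      trans (length-++ (map (at c) (cells B)))
        (cong₂ _+_ (length-map (at c) (cells B)) (length-layout (c + size B) Bs))

    module Placement (S : List (Elem n k)) where
      open Positions S

      Placed : ℕ → Pattern → Set
      Placed c Γ = ∀ {κe} → κe ∈ Γ → at c κe ∈ S

      module _ {c : ℕ} {Γ : Pattern} (pl : Placed c Γ) where

        outerCov⇒TV : ∀ {e} → OuterCov Γ e → TV (c + e)
        outerCov⇒TV (bySpoke m) = lose (pl m) (inj₂ left)
        outerCov⇒TV (byRimˡ m) = lose (pl m) (inj₂ left)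
        outerCov⇒TV (byRimʳ {e} m) = subst TV (+-assoc c e 1) (lose (pl m) (inj₂ right))

        innerCov⇒TU : ∀ {e} → InnerCov k Γ e → TU (c + e)
        innerCov⇒TU (byVertex m) = DU⇒TU (pl m)
        innerCov⇒TU (bySpoke m) = lose (pl m) (inj₂ right)
        innerCov⇒TU (byInnˡ m) = lose (pl m) (inj₂ left)
        innerCov⇒TU (byInnʳ {e} m) = subst TU (+-assoc c e k) (lose (pl m) (inj₂ right))

      -- What a block offers to its predecessor, stated for a position of the graph without naming
      -- the block that starts there.
      record Entry (c : ℕ) : Set where
        field
          cov : ∀ e → e < k → k ≤ e + 2 * h → TU (c + e)
          vtx : ∀ j → 2 * j < k → k ≤ 2 * j + 2 * h → DU (c + 2 * j)
      open Entry

      block-entry : ∀ {c} (B : Block k h) → Placed c (cells B) → Entry c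
      block-entry B pl .cov e lt le = innerCov⇒TU pl (entry-touched B e lt le)
      block-entry B pl .vtx j lt le = pl (entry-vertex B j lt le)

      entry-wrap : Entry 0 → Entry n
      entry-wrap E .cov e lt le =
        subst (Touched S ∘ inner) (sym (n+i-mod e)) (cov E e lt le)
      entry-wrap E .vtx j lt le =
        subst (λ f → vx (inner f) ∈ S) (sym (n+i-mod (2 * j))) (vtx E j lt le)

      exposed⇒InnerOK : ∀ {c ℓ Γ e} → Placed c Γ → Entry (c + ℓ) → e < ℓ →
                        Exposed k h ℓ Γ e → InnerOK (c + e)
      exposed⇒InnerOK {c} {ℓ} {Γ} {e} pl E e<ℓ x = inj₂ (dominated x)
        where
        back : ∀ {d} → e ≡ d + k → (innerV , d) ∈ Γ → ∃ λ d′ → c + e ≡ d′ + k × DU d′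
        back {d} refl m = c + d , sym (+-assoc c d k) , pl m
        over : ∀ {e′} → e + k ≡ ℓ + e′ → c + ℓ + e′ ≡ c + e + k
        over {e′} eq = trans (+-assoc c ℓ e′) (trans (cong (c +_) (sym eq)) (sym (+-assoc c e k)))
        -- Column e lies inside the block, so e + k reaches fewer than k columns into the next one,
        -- where the entry conditions speak.
        below-k : ∀ {e′} → e + k ≡ ℓ + e′ → e′ < k
        below-k {e′} eq = +-cancelˡ-< ℓ e′ k (subst (_< ℓ + k) eq (+-monoˡ-< k e<ℓ))
        dominated : Exposed k h ℓ Γ e →
                    TU (c + e + k) × (DU (c + e + k) ⊎ ∃ λ d → c + e ≡ d + k × DU d)
        dominated (behind d eq m t) =
          subst TU (sym (+-assoc c e k)) (innerCov⇒TU pl t) , inj₂ (back eq m)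
        dominated (ahead m) = DU⇒TU du , inj₁ du
          where du = subst DU (sym (+-assoc c e k)) (pl m)
        dominated (across-behind d e′ eq m eq′ le) =
          subst TU (over eq′) (cov E e′ (below-k eq′) le) , inj₂ (back eq m)
        dominated (across-ahead j eq le) = DU⇒TU du , inj₁ du
          where du = subst DU (over eq) (vtx E j (below-k eq) le)

      -- A nonempty list offers the entry of its first block; an empty one passes on the entry at
      -- its end.
      head-entry : ∀ c Bs → (∀ {s} → s ∈ layout c Bs → s ∈ S) →
                   Entry (c + totalSize Bs) → Entry c
      head-entry c []       _   E = subst Entry (+-identityʳ c) E
      head-entry c (B ∷ Bs) sub E = block-entry B (sub ∘ ∈-++⁺ˡ ∘ ∈-map⁺ (at c))

      layout-ok : ∀ c Bs → (∀ {s} → s ∈ layout c Bs → s ∈ S) → Entry (c + totalSize Bs) →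
                  ∀ i → i < totalSize Bs → OuterOK (c + i) × InnerOK (c + i)
      layout-ok c (B ∷ Bs) sub E i lt = cases
        where
        E′ : Entry (c + size B + totalSize Bs)
        E′ = subst Entry (sym (+-assoc c (size B) _)) E
        rest : ∀ {s} → s ∈ layout (c + size B) Bs → s ∈ S
        rest = sub ∘ ∈-++⁺ʳ (map (at c) (cells B))
        pl : Placed c (cells B)
        pl = sub ∘ ∈-++⁺ˡ ∘ ∈-map⁺ (at c)
        here-ok : i < size B → OuterOK (c + i) × InnerOK (c + i)
        here-ok i<ℓ = o (outer-valid B i i<ℓ) , u (inner-valid B i i<ℓ)
          where
          o : OuterCov (cells B) i ⊎ _ → OuterOK (c + i)
          o (inj₁ t) = inj₁ (outerCov⇒TV pl t)
          o (inj₂ (d , t)) = inj₂ (pl d , subst TV (sym (+-assoc c i 1)) (outerCov⇒TV pl t))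
          u : InnerCov k (cells B) i ⊎ _ → InnerOK (c + i)
          u (inj₁ t) = inj₁ (innerCov⇒TU pl t)
          u (inj₂ x) = exposed⇒InnerOK pl (head-entry _ Bs rest E′) i<ℓ x
        cases : OuterOK (c + i) × InnerOK (c + i)
        cases with i <? size B
        ... | yes i<ℓ = here-ok i<ℓ
        ... | no i≮ℓ =
          subst (λ z → OuterOK z × InnerOK z) eq
            (layout-ok (c + size B) Bs rest E′ (i ∸ size B) lt′)
          where
          ℓ≤i = ≮⇒≥ i≮ℓ
          eq : c + size B + (i ∸ size B) ≡ c + i
          eq = trans (+-assoc c (size B) _) (cong (c +_) (m+[n∸m]≡n ℓ≤i))
          lt′ : i ∸ size B < totalSize Bs
          lt′ = +-cancelˡ-< (size B) _ _ (subst (_< size B + totalSize Bs) (sym (m+[n∸m]≡n ℓ≤i)) lt)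

    blocks⇒γmd≤ : ∀ B Bs → totalSize (B ∷ Bs) ≡ n → γmd≤ n k (totalCost (B ∷ Bs))
    blocks⇒γmd≤ B Bs eq = S , positions⇒dominating ok , ≤-reflexive (length-layout 0 (B ∷ Bs))
      where
      S : List (Elem n k)
      S = layout 0 (B ∷ Bs)
      open Positions S
      open Placement S
      -- The cycle closes here: the first block is the successor of the last.
      wrap : Entry n
      wrap = entry-wrap (block-entry {c = 0} B (∈-++⁺ˡ ∘ ∈-map⁺ (at 0)))
      ok : ∀ i → i < n → OuterOK i × InnerOK i
      ok i i<n = layout-ok 0 (B ∷ Bs) id (subst Entry (sym eq) wrap) i (subst (i <_) (sym eq) i<n)

-- Parity, splitting of ranges, and runs of step two.

data Parity : ℕ → Set where
  even : ∀ j → Parity (2 * j)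
  odd  : ∀ j → Parity (1 + 2 * j)

parity : ∀ x → Parity x
parity zero = even 0
parity (suc x) with parity x
... | even j = odd j
... | odd j  = subst Parity (double j) (even (suc j))
  where double : ∀ j → 2 * suc j ≡ suc (suc (2 * j))
        double = solve-∀

half-< : ∀ {j s} → 2 * j < 2 * s → j < s
half-< {j} {s} = *-cancelˡ-< 2 j s

half-<ʳ : ∀ {j s} → 1 + 2 * j < 2 * s → j < s
half-<ʳ {j} lt = half-< (<-trans (n<1+n (2 * j)) lt)

data Split (a : ℕ) : ℕ → Set where
  below : ∀ {e} → e < a → Split a e
  above : ∀ x → Split a (a + x)

split : ∀ a e → Split a e
split a e with e <? a
... | yes e<a = below e<a
... | no e≮a  = subst (Split a) (m+[n∸m]≡n (≮⇒≥ e≮a)) (above (e ∸ a))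

run : Kind → ℕ → ℕ → Pattern
run κ b s = applyUpTo (λ j → κ , b + 2 * j) s

length-run : ∀ κ b s → length (run κ b s) ≡ s
length-run κ b s = length-applyUpTo (λ j → κ , b + 2 * j) s

∈-run : ∀ κ b {j s} → j < s → (κ , b + 2 * j) ∈ run κ b s
∈-run κ b = ∈-applyUpTo⁺ (λ j → κ , b + 2 * j)

-- The standard block.

module Standard (k h a s : ℕ) (0<s : 0 < s) (s≤h : s ≤ h)
                (2h≤k : 2 * h ≤ k) (k≤2a+1 : k ≤ 1 + 2 * a) where

  ℓ : ℕ
  ℓ = 1 + 2 * a + 2 * s

  Γ : Pattern
  Γ = run innerV 0 (suc a) ++ run spokeE 1 a ++ run rimE (1 + 2 * a) s

  vertex : ∀ {j} → j ≤ a → (innerV , 2 * j) ∈ Γ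
  vertex j≤a = ∈-++⁺ˡ (∈-run innerV 0 (s≤s j≤a))

  spoke′ : ∀ {j} → j < a → (spokeE , 1 + 2 * j) ∈ Γ
  spoke′ j<a = ∈-++⁺ʳ (run innerV 0 (suc a)) (∈-++⁺ˡ (∈-run spokeE 1 j<a))

  rim′ : ∀ {j} → j < s → (rimE , 1 + 2 * a + 2 * j) ∈ Γ
  rim′ j<s = ∈-++⁺ʳ (run innerV 0 (suc a)) (∈-++⁺ʳ (run spokeE 1 a) (∈-run rimE (1 + 2 * a) j<s))

  low : ∀ {e} → e < 1 + 2 * a →
        (∃ λ j → e ≡ 2 * j × j ≤ a) ⊎ (∃ λ j → e ≡ 1 + 2 * j × j < a)
  low {e} lt with parity e
  ... | even j = inj₁ (j , refl , *-cancelˡ-≤ 2 (≤-pred lt))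
  ... | odd j  = inj₂ (j , refl , half-< {j} (≤-pred lt))

  cov : ∀ e → e < 1 + 2 * a → InnerCov k Γ e
  cov e lt with low lt
  ... | inj₁ (j , refl , j≤a) = byVertex (vertex j≤a)
  ... | inj₂ (j , refl , j<a) = bySpoke (spoke′ j<a)

  next-cov : ∀ {j} → j ≤ a → OuterCov Γ (2 * j + 1)
  next-cov {j} j≤a with m≤n⇒m<n∨m≡n j≤a
  ... | inj₁ j<a  = subst (OuterCov Γ) (+-comm 1 (2 * j)) (bySpoke (spoke′ j<a))
  -- After the last inner vertex, in column 2a, the next outer vertex is an end of the first rim
  -- edge; this is where s must be positive.
  ... | inj₂ refl = subst (OuterCov Γ) (eq j) (byRimˡ (rim′ 0<s))
    where eq : ∀ j → 1 + 2 * j + 0 ≡ 2 * j + 1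
          eq = solve-∀

  outer-ok : ∀ e → e < ℓ → OuterCov Γ e ⊎ ((innerV , e) ∈ Γ × OuterCov Γ (e + 1))
  outer-ok e lt with split (1 + 2 * a) e
  ... | below e< with low e<
  ...   | inj₁ (j , refl , j≤a) = inj₂ (vertex j≤a , next-cov j≤a)
  ...   | inj₂ (j , refl , j<a) = inj₁ (bySpoke (spoke′ j<a))
  outer-ok e lt | above x with parity x
  ...   | even j = inj₁ (byRimˡ (rim′ (half-< {j} (+-cancelˡ-< (1 + 2 * a) _ _ lt))))
  ...   | odd j  = inj₁ (subst (OuterCov Γ) (eq a j)
                     (byRimʳ (rim′ (half-<ʳ {j} (+-cancelˡ-< (1 + 2 * a) _ _ lt)))))
    where eq : ∀ a j → 1 + 2 * a + 2 * j + 1 ≡ 1 + 2 * a + (1 + 2 * j)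
          eq = solve-∀

  -- The column k behind is y + x, in the alternating part of this block; the column k ahead is x +
  -- v of the next block, which is touched. If x + v is even, its inner vertex dominates; otherwise
  -- y + x is even and its inner vertex does.
  exposed : ∀ x → x < 2 * s → Exposed k h ℓ Γ (1 + 2 * a + x)
  exposed x x<2s = go (parity (x + v)) (parity (y + x)) refl refl
    where
    2s≤2h : 2 * s ≤ 2 * h
    2s≤2h = *-monoʳ-≤ 2 s≤h
    v = k ∸ 2 * s
    k-eq : 2 * s + v ≡ k
    k-eq = m+[n∸m]≡n (≤-trans 2s≤2h 2h≤k)
    y = 1 + 2 * a ∸ k
    y-eq : k + y ≡ 1 + 2 * a
    y-eq = m+[n∸m]≡n k≤2a+1
    target : 1 + 2 * a + x + k ≡ ℓ + (x + v)
    target = trans (cong (1 + 2 * a + x +_) (sym k-eq)) (eq a x s v)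
      where eq : ∀ a x s v → 1 + 2 * a + x + (2 * s + v) ≡ 1 + 2 * a + 2 * s + (x + v)
            eq = solve-∀
    source : 1 + 2 * a + x ≡ y + x + k
    source = trans (cong (_+ x) (sym y-eq)) (eq k y x)
      where eq : ∀ k y x → k + y + x ≡ y + x + k
            eq = solve-∀
    enter : k ≤ x + v + 2 * h
    enter = subst (_≤ x + v + 2 * h) k-eq
      (≤-trans (≤-reflexive (+-comm (2 * s) v)) (+-mono-≤ (m≤n+m v x) 2s≤2h))
    y+x< : y + x < 1 + 2 * a
    y+x< = subst (y + x <_) (trans (+-comm y k) y-eq)
             (+-monoʳ-< y (<-≤-trans x<2s (≤-trans 2s≤2h 2h≤k)))
    go : ∀ {p q} → Parity p → Parity q → x + v ≡ p → y + x ≡ q → Exposed k h ℓ Γ (1 + 2 * a + x)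
    go (even j) _ p≡ _ = across-ahead j (trans target (cong (ℓ +_) p≡))
                            (subst (λ z → k ≤ z + 2 * h) p≡ enter)
    go (odd j) (even i) _ q≡ =
      across-behind (y + x) (x + v) source
        (subst (λ z → (innerV , z) ∈ Γ) (sym q≡)
          (vertex {i} (*-cancelˡ-≤ 2 (≤-pred (subst (_< 1 + 2 * a) q≡ y+x<)))))
        target enter
    -- The offsets x + v and y + x of the two columns at distance k have opposite parity.
    go (odd j) (odd i) p≡ q≡ = contradiction parities (even≢odd (s + (1 + j + i)) (x + a))
      where
      l₁ : ∀ s j i → 2 * (s + (1 + j + i)) ≡ 2 * s + ((1 + 2 * j) + (1 + 2 * i))
      l₁ = solve-∀
      l₂ : ∀ s x v y → 2 * s + ((x + v) + (y + x)) ≡ 2 * x + ((2 * s + v) + y)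
      l₂ = solve-∀
      l₃ : ∀ x a → 2 * x + (1 + 2 * a) ≡ 1 + 2 * (x + a)
      l₃ = solve-∀
      parities : 2 * (s + (1 + j + i)) ≡ 1 + 2 * (x + a)
      parities =
        trans (l₁ s j i) (trans (cong₂ (λ p q → 2 * s + (p + q)) (sym p≡) (sym q≡))
        (trans (l₂ s x v y) (trans (cong (λ z → 2 * x + (z + y)) k-eq)
        (trans (cong (2 * x +_) y-eq) (l₃ x a)))))

  inner-ok : ∀ e → e < ℓ → InnerCov k Γ e ⊎ Exposed k h ℓ Γ e
  inner-ok e lt with split (1 + 2 * a) e
  ... | below e< = inj₁ (cov e e<)
  ... | above x  = inj₂ (exposed x (+-cancelˡ-< (1 + 2 * a) _ _ lt))

  block : Block k h
  block = record
    { size = ℓ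
    ; cells = Γ
    ; outer-valid = outer-ok
    ; inner-valid = inner-ok
    ; entry-touched = λ e e<k _ → cov e (<-≤-trans e<k k≤2a+1)
    ; entry-vertex = λ j lt _ → vertex {j} (*-cancelˡ-≤ 2 (≤-pred (<-≤-trans lt k≤2a+1)))
    }

  block-cost : cost block ≡ 1 + 2 * a + s
  block-cost = trans (length-++ (run innerV 0 (suc a)))
    (trans (cong₂ _+_ (length-run innerV 0 (suc a))
       (trans (length-++ (run spokeE 1 a))
         (cong₂ _+_ (length-run spokeE 1 a) (length-run rimE (1 + 2 * a) s)))) (eq a s))
    where eq : ∀ a s → suc a + (a + s) ≡ 1 + 2 * a + s
          eq = solve-∀

-- Blocks of length T + 3.

-- The block of length T + 3 for even k: the rim pair in columns 2h and 2h + 1 relies on the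
-- inner vertices in columns 0 and 4h + 1.
module EvenPlusThree (g : ℕ) where

  h k ℓ : ℕ
  h = suc g
  k = 2 * h
  ℓ = 4 * h + 4

  Γ : Pattern
  Γ = run innerV 0 h ++ run spokeE 1 h ++ run innerV (2 * h + 3) h ++
      run spokeE (2 * h + 2) (suc h) ++ (rimE , 2 * h) ∷ (spokeE , 4 * h + 3) ∷ []

  vertex₁ : ∀ {j} → j < h → (innerV , 2 * j) ∈ Γ
  vertex₁ lt = ∈-++⁺ˡ (∈-run innerV 0 lt)

  spoke₁ : ∀ {j} → j < h → (spokeE , 1 + 2 * j) ∈ Γ
  spoke₁ lt = ∈-++⁺ʳ (run innerV 0 h) (∈-++⁺ˡ (∈-run spokeE 1 lt))

  vertex₂ : ∀ {j} → j < h → (innerV , 2 * h + 3 + 2 * j) ∈ Γ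
  vertex₂ lt = ∈-++⁺ʳ (run innerV 0 h) (∈-++⁺ʳ (run spokeE 1 h)
                 (∈-++⁺ˡ (∈-run innerV (2 * h + 3) lt)))

  extras : ∀ {x} → x ∈ run spokeE (2 * h + 2) (suc h) ++ (rimE , 2 * h) ∷ (spokeE , 4 * h + 3) ∷ [] →
           x ∈ Γ
  extras m = ∈-++⁺ʳ (run innerV 0 h) (∈-++⁺ʳ (run spokeE 1 h)
               (∈-++⁺ʳ (run innerV (2 * h + 3) h) m))

  spoke₂ : ∀ {j} → j ≤ h → (spokeE , 2 * h + 2 + 2 * j) ∈ Γ
  spoke₂ le = extras (∈-++⁺ˡ (∈-run spokeE (2 * h + 2) (s≤s le)))

  theRim : (rimE , 2 * h) ∈ Γ
  theRim = extras (∈-++⁺ʳ (run spokeE (2 * h + 2) (suc h)) (here refl))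

  lastSpoke : (spokeE , 4 * h + 3) ∈ Γ
  lastSpoke = extras (∈-++⁺ʳ (run spokeE (2 * h + 2) (suc h)) (there (here refl)))

  data Column : ℕ → Set where
    V₁ : ∀ {j} → j < h → Column (2 * j)
    S₁ : ∀ {j} → j < h → Column (1 + 2 * j)
    R₀ : Column (2 * h)
    R₁ : Column (2 * h + 1)
    S₂ : ∀ {j} → j ≤ h → Column (2 * h + 2 + 2 * j)
    V₂ : ∀ {j} → j < h → Column (2 * h + 3 + 2 * j)
    S₃ : Column (4 * h + 3)

  column : ∀ e → e < ℓ → Column e
  column e lt with split (2 * h) e
  ... | below e< with parity e
  ...   | even j = V₁ (half-< {j} e<)
  ...   | odd j  = S₁ (half-<ʳ {j} e<)
  column e lt | above 0 = subst Column (sym (+-identityʳ (2 * h))) R₀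
  column e lt | above 1 = R₁
  column e lt | above (suc (suc x)) = subst Column (+-assoc (2 * h) 2 x) (tail (parity x) x<)
    where
    total : ∀ h → 4 * h + 4 ≡ 2 * h + (2 + 2 * (1 + h))
    total = solve-∀
    x< : x < 2 * (1 + h)
    x< = +-cancelˡ-< 2 _ _ (+-cancelˡ-< (2 * h) _ _ (subst (2 * h + (2 + x) <_) (total h) lt))
    tail : ∀ {x} → Parity x → x < 2 * (1 + h) → Column (2 * h + 2 + x)
    tail (even j) x< = S₂ (≤-pred (half-< {j} x<))
    tail (odd j) x< with m≤n⇒m<n∨m≡n (≤-pred (half-<ʳ {j} x<))
    ... | inj₁ j<h  = subst Column (eq h j) (V₂ j<h)
      where eq : ∀ h j → 2 * h + 3 + 2 * j ≡ 2 * h + 2 + (1 + 2 * j)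
            eq = solve-∀
    ... | inj₂ refl = subst Column (eq h) S₃
      where eq : ∀ h → 4 * h + 3 ≡ 2 * h + 2 + (1 + 2 * h)
            eq = solve-∀

  outer-ok : ∀ {e} → Column e → OuterCov Γ e ⊎ ((innerV , e) ∈ Γ × OuterCov Γ (e + 1))
  outer-ok (V₁ {j} lt) = inj₂ (vertex₁ lt , subst (OuterCov Γ) (+-comm 1 (2 * j)) (bySpoke (spoke₁ lt)))
  outer-ok (S₁ lt) = inj₁ (bySpoke (spoke₁ lt))
  outer-ok R₀ = inj₁ (byRimˡ theRim)
  outer-ok R₁ = inj₁ (byRimʳ theRim)
  outer-ok (S₂ le) = inj₁ (bySpoke (spoke₂ le))
  outer-ok (V₂ {j} lt) = inj₂ (vertex₂ lt , subst (OuterCov Γ) (eq h j) (bySpoke (spoke₂ lt)))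
    where eq : ∀ h j → 2 * h + 2 + 2 * (1 + j) ≡ 2 * h + 3 + 2 * j + 1
          eq = solve-∀
  outer-ok S₃ = inj₁ (bySpoke lastSpoke)

  -- Only the rim pair is exposed, and it is settled inside the block, so nothing is asked of the
  -- block that follows.
  inner-ok : ∀ {e} → Column e → InnerCov k Γ e ⊎ Exposed k h ℓ Γ e
  inner-ok (V₁ lt) = inj₁ (byVertex (vertex₁ lt))
  inner-ok (S₁ lt) = inj₁ (bySpoke (spoke₁ lt))
  inner-ok R₀ = inj₂ (behind 0 refl (vertex₁ z<s)
    (subst (InnerCov k Γ) (eq g) (bySpoke (spoke₂ (n≤1+n g)))))
    where eq : ∀ g → 2 * suc g + 2 + 2 * g ≡ 2 * suc g + 2 * suc g
          eq = solve-∀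
  inner-ok R₁ = inj₂ (ahead (subst (λ z → (innerV , z) ∈ Γ) (eq g) (vertex₂ (n<1+n g))))
    where eq : ∀ g → 2 * suc g + 3 + 2 * g ≡ 2 * suc g + 1 + 2 * suc g
          eq = solve-∀
  inner-ok (S₂ le) = inj₁ (bySpoke (spoke₂ le))
  inner-ok (V₂ lt) = inj₁ (byVertex (vertex₂ lt))
  inner-ok S₃ = inj₁ (bySpoke lastSpoke)

  entry-cov : ∀ e → e < k → InnerCov k Γ e
  entry-cov e lt with parity e
  ... | even j = byVertex (vertex₁ (half-< {j} lt))
  ... | odd j  = bySpoke (spoke₁ (half-<ʳ {j} lt))

  block : Block k h
  block = record
    { size = ℓ
    ; cells = Γ
    ; outer-valid = λ e lt → outer-ok (column e lt)
    ; inner-valid = λ e lt → inner-ok (column e lt)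
    ; entry-touched = λ e lt _ → entry-cov e lt
    ; entry-vertex = λ j lt _ → vertex₁ (half-< {j} lt)
    }

  block-cost : cost block ≡ 4 * h + 3
  block-cost =
    trans (length-++ (run innerV 0 h)) (trans (cong₂ _+_ (length-run innerV 0 h)
    (trans (length-++ (run spokeE 1 h)) (cong₂ _+_ (length-run spokeE 1 h)
    (trans (length-++ (run innerV (2 * h + 3) h)) (cong₂ _+_ (length-run innerV (2 * h + 3) h)
    (trans (length-++ (run spokeE (2 * h + 2) (suc h)))
      (cong (_+ 2) (length-run spokeE (2 * h + 2) (suc h))))))))) (eq h))
    where eq : ∀ h → h + (h + (h + (suc h + 2))) ≡ 4 * h + 3
          eq = solve-∀

-- The block of length T + 3 for odd k: the half patterns at 0 and at k start with a rim pair
-- of untouched inner vertices.  The inner edge u₁u₁₊ₖ and the vertex uₖ repair these, and uₖ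
-- also dominates u₂ₖ in the final rim pair.
module OddPlusThree (g : ℕ) where

  h k ℓ : ℕ
  h = suc g
  k = 3 + 2 * g
  ℓ = k + k + 2

  half : ℕ → Pattern
  half c = run innerV (c + 2) (suc g) ++ run spokeE (c + 3) g ++ (rimE , c) ∷ []

  Γ : Pattern
  Γ = half 0 ++ half k ++ (innE , 1) ∷ (innerV , k) ∷ (rimE , k + k) ∷ []

  half₁ : ∀ {x} → x ∈ half 0 → x ∈ Γ
  half₁ = ∈-++⁺ˡ
  half₂ : ∀ {x} → x ∈ half k → x ∈ Γ
  half₂ m = ∈-++⁺ʳ (half 0) (∈-++⁺ˡ m)
  extras : ∀ {x} → x ∈ (innE , 1) ∷ (innerV , k) ∷ (rimE , k + k) ∷ [] → x ∈ Γ
  extras m = ∈-++⁺ʳ (half 0) (∈-++⁺ʳ (half k) m)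

  vertex : ∀ c {j} → j ≤ g → (innerV , c + 2 + 2 * j) ∈ half c
  vertex c le = ∈-++⁺ˡ (∈-run innerV (c + 2) (s≤s le))
  spoke′ : ∀ c {j} → j < g → (spokeE , c + 3 + 2 * j) ∈ half c
  spoke′ c lt = ∈-++⁺ʳ (run innerV (c + 2) (suc g)) (∈-++⁺ˡ (∈-run spokeE (c + 3) lt))
  rim₀ : ∀ c → (rimE , c) ∈ half c
  rim₀ c = ∈-++⁺ʳ (run innerV (c + 2) (suc g)) (∈-++⁺ʳ (run spokeE (c + 3) g) (here refl))

  data Column (c : ℕ) : ℕ → Set where
    R₀ : Column c (c + 0)
    R₁ : Column c (c + 1)
    V  : ∀ {j} → j ≤ g → Column c (c + 2 + 2 * j)
    S  : ∀ {j} → j < g → Column c (c + 3 + 2 * j)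

  column : ∀ c x → x < k → Column c (c + x)
  column c 0 _ = R₀
  column c 1 _ = R₁
  column c (suc (suc x)) lt = subst (Column c) (+-assoc c 2 x) (tail (parity x) (≤-pred (≤-pred lt)))
    where
    tail : ∀ {x} → Parity x → x < 1 + 2 * g → Column c (c + 2 + x)
    tail (even j) x< = V {j = j} (*-cancelˡ-≤ 2 (≤-pred x<))
    tail (odd j)  x< = subst (Column c) (eq c j) (S (half-< {j} (≤-pred x<)))
      where eq : ∀ c j → c + 3 + 2 * j ≡ c + 2 + (1 + 2 * j)
            eq = solve-∀

  -- A half ends with an inner vertex, so the outer vertex after it must be touched; hence the
  -- hypothesis that a rim edge starts at c + k.
  outer-half : ∀ c → (∀ {x} → x ∈ half c → x ∈ Γ) → (rimE , c + k) ∈ Γ → ∀ {e} → Column c e →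
               OuterCov Γ e ⊎ ((innerV , e) ∈ Γ × OuterCov Γ (e + 1))
  outer-half c sub next R₀ = inj₁ (subst (OuterCov Γ) (sym (+-identityʳ c)) (byRimˡ (sub (rim₀ c))))
  outer-half c sub next R₁ = inj₁ (byRimʳ (sub (rim₀ c)))
  outer-half c sub next (S lt) = inj₁ (bySpoke (sub (spoke′ c lt)))
  outer-half c sub next (V {j} le) = inj₂ (sub (vertex c le) , after (m≤n⇒m<n∨m≡n le))
    where
    after : j < g ⊎ j ≡ g → OuterCov Γ (c + 2 + 2 * j + 1)
    after (inj₁ lt) = subst (OuterCov Γ) (eq c j) (bySpoke (sub (spoke′ c lt)))
      where eq : ∀ c j → c + 3 + 2 * j ≡ c + 2 + 2 * j + 1
            eq = solve-∀
    after (inj₂ refl) = subst (OuterCov Γ) (eq c g) (byRimˡ next)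
      where eq : ∀ c g → c + (3 + 2 * g) ≡ c + 2 + 2 * g + 1
            eq = solve-∀

  inner-half : ∀ c → (∀ {x} → x ∈ half c → x ∈ Γ) → ∀ {e} → Column c e →
               InnerCov k Γ e ⊎ (e ≡ c + 0 ⊎ e ≡ c + 1)
  inner-half c sub R₀ = inj₂ (inj₁ refl)
  inner-half c sub R₁ = inj₂ (inj₂ refl)
  inner-half c sub (S lt) = inj₁ (bySpoke (sub (spoke′ c lt)))
  inner-half c sub (V le) = inj₁ (byVertex (sub (vertex c le)))

  crossing : (innE , 1) ∈ Γ
  crossing = extras (here refl)
  vertex-k : (innerV , k) ∈ Γ
  vertex-k = extras (there (here refl))
  rim-2k : (rimE , k + k) ∈ Γ
  rim-2k = extras (there (there (here refl)))

  tail-offset : ∀ {x} → k + (k + x) < ℓ → x ≡ 0 ⊎ x ≡ 1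
  tail-offset {0} _ = inj₁ refl
  tail-offset {1} _ = inj₂ refl
  tail-offset {suc (suc x)} lt with +-cancelˡ-< (k + k) _ _ (subst (_< ℓ) (sym (+-assoc k k _)) lt)
  ... | s<s (s<s ())

  outer-ok : ∀ e → e < ℓ → OuterCov Γ e ⊎ ((innerV , e) ∈ Γ × OuterCov Γ (e + 1))
  outer-ok e lt with split k e
  ... | below e< = outer-half 0 half₁ (half₂ (rim₀ k)) (column 0 e e<)
  ... | above x with split k x
  ...   | below x< = outer-half k half₂ rim-2k (column k x x<)
  ...   | above y with tail-offset lt
  ...     | inj₁ refl = inj₁ (subst (OuterCov Γ) (cong (k +_) (sym (+-identityʳ k))) (byRimˡ rim-2k))
  ...     | inj₂ refl = inj₁ (subst (OuterCov Γ) (+-assoc k k 1) (byRimʳ rim-2k))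

  inner-ok : ∀ e → e < ℓ → InnerCov k Γ e ⊎ Exposed k h ℓ Γ e
  inner-ok e lt with split k e
  ... | below e< with inner-half 0 half₁ (column 0 e e<)
  ...   | inj₁ t = inj₁ t
  ...   | inj₂ (inj₁ refl) = inj₂ (ahead vertex-k)
  ...   | inj₂ (inj₂ refl) = inj₁ (byInnˡ crossing)
  inner-ok e lt | above x with split k x
  ...   | below x< with inner-half k half₂ (column k x x<)
  ...     | inj₁ t = inj₁ t
  ...     | inj₂ (inj₁ eq) =
    inj₁ (subst (InnerCov k Γ) (trans (sym (+-identityʳ k)) (sym eq)) (byVertex vertex-k))
  ...     | inj₂ (inj₂ eq) =
    inj₁ (subst (InnerCov k Γ) (trans (+-comm 1 k) (sym eq)) (byInnʳ crossing))
  inner-ok e lt | above x | above y with tail-offset lt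
  -- Column 2k lies k after the vertex in column k, and k before column k - 2 = 1 + 2g of the next
  -- block.
  ...     | inj₁ refl = inj₂ (across-behind k (1 + 2 * g) (cong (k +_) (+-identityʳ k)) vertex-k (eq g)
                           (≤-trans (m≤m+n k (2 * g)) (≤-reflexive (le g))))
    where eq : ∀ g → let k = 3 + 2 * g in k + (k + 0) + k ≡ k + k + 2 + (1 + 2 * g)
          eq = solve-∀
          le : ∀ g → 3 + 2 * g + 2 * g ≡ 1 + 2 * g + 2 * suc g
          le = solve-∀
  -- Column 2k + 1 lies k before column k - 1 = 2h of the next block, an even one.
  ...     | inj₂ refl = inj₂ (across-ahead (suc g) (eq g)
                           (≤-trans (m≤m+n k (1 + 2 * g)) (≤-reflexive (le g))))
    where eq : ∀ g → let k = 3 + 2 * g in k + (k + 1) + k ≡ k + k + 2 + 2 * suc g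
          eq = solve-∀
          le : ∀ g → 3 + 2 * g + (1 + 2 * g) ≡ 2 * suc g + 2 * suc g
          le = solve-∀

  not-below : ¬ (k ≤ 2 * h)
  not-below le = 1+n≰n (subst (k ≤_) (eq g) le)
    where eq : ∀ g → 2 * suc g ≡ 2 + 2 * g
          eq = solve-∀

  -- Here k - 2h = 1, so the entry conditions exempt exactly column 0, the one column below k whose
  -- inner vertex this block leaves untouched.
  entry-cov : ∀ e → e < k → k ≤ e + 2 * h → InnerCov k Γ e
  entry-cov e lt le with inner-half 0 half₁ (column 0 e lt)
  ... | inj₁ t = t
  ... | inj₂ (inj₁ refl) = contradiction le not-below
  ... | inj₂ (inj₂ refl) = byInnˡ crossing

  entry-vtx : ∀ j → 2 * j < k → k ≤ 2 * j + 2 * h → (innerV , 2 * j) ∈ Γ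
  entry-vtx zero lt le = contradiction le not-below
  entry-vtx (suc j) lt le =
    subst (λ z → (innerV , z) ∈ Γ) (eq j) (half₁ (vertex 0 {j} (*-cancelˡ-≤ 2 (≤-pred (≤-pred (≤-pred
      (subst (_< k) (sym (eq j)) lt)))))))
    where eq : ∀ j → 2 + 2 * j ≡ 2 * suc j
          eq = solve-∀

  block : Block k h
  block = record
    { size = ℓ ; cells = Γ ; outer-valid = outer-ok ; inner-valid = inner-ok
    ; entry-touched = entry-cov ; entry-vertex = entry-vtx }

  length-half : ∀ c → length (half c) ≡ 2 * h
  length-half c =
    trans (length-++ (run innerV (c + 2) (suc g))) (trans (cong₂ _+_ (length-run innerV (c + 2) (suc g))
    (trans (length-++ (run spokeE (c + 3) g)) (cong (_+ 1) (length-run spokeE (c + 3) g)))) (eq g))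
    where eq : ∀ g → suc g + (g + 1) ≡ 2 * suc g
          eq = solve-∀

  block-cost : cost block ≡ 4 * h + 3
  block-cost =
    trans (length-++ (half 0)) (trans (cong₂ _+_ (length-half 0)
    (trans (length-++ (half k)) (cong (_+ 3) (length-half k)))) (eq h))
    where eq : ∀ h → 2 * h + (2 * h + 3) ≡ 4 * h + 3
          eq = solve-∀

-- Standard blocks cannot fill T + 3 columns: one has odd length, and two with a ≥ h would need
-- s-values summing to at most 1, though each is positive. The cost is (3h + 1) + h + 2, just what
-- the bound allows.
blockPlusThree : ∀ g k → k ≡ 2 * suc g ⊎ k ≡ 1 + 2 * suc g →
  ∃ λ (B : Block k (suc g)) → size B ≡ 4 * suc g + 4 × cost B ≡ 4 * suc g + 3
blockPlusThree g _ (inj₁ refl) = block , refl , block-cost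
  where open EvenPlusThree g
blockPlusThree g _ (inj₂ refl) =
  subst (λ k → ∃ λ (B : Block k (suc g)) →
                 size B ≡ 4 * suc g + 4 × cost B ≡ 4 * suc g + 3)
    (eq g) (block , size-eq g , block-cost)
  where
  open OddPlusThree g
  eq : ∀ g → 3 + 2 * g ≡ 1 + 2 * suc g
  eq = solve-∀
  size-eq : ∀ g → 3 + 2 * g + (3 + 2 * g) + 2 ≡ 4 * suc g + 4
  size-eq = solve-∀

-- Choosing blocks according to the remainder.

-- Distributes the rim edges over two standard blocks, each of which takes between 1 and h.
splitSum : ∀ h ρ → ρ + 2 < 2 * h →
  ∃ λ a → ∃ λ b → 0 < a × a ≤ h × 0 < b × b ≤ h × a + b ≡ ρ + 2
splitSum h ρ lt with ρ + 1 ≤? h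
... | yes le = 1 , ρ + 1 , z<s , ≤-trans (m≤n+m 1 ρ) le , m≤n+m 1 ρ , le , eq ρ
  where eq : ∀ ρ → 1 + (ρ + 1) ≡ ρ + 2
        eq = solve-∀
... | no ≰h = h , ρ + 2 ∸ h , 0<h h lt , ≤-refl , m<n⇒0<n∸m h<ρ+2 ,
              +-cancelˡ-≤ h _ _ (subst₂ _≤_ (sym sum) (cong (h +_) (+-identityʳ h)) (<⇒≤ lt)) , sum
  where
  0<h : ∀ h → ρ + 2 < 2 * h → 0 < h
  0<h (suc h) _ = z<s
  h<ρ+2 : h < ρ + 2
  h<ρ+2 = <-≤-trans (≰⇒> ≰h) (+-monoʳ-≤ ρ (n≤1+n 1))
  sum : h + (ρ + 2 ∸ h) ≡ ρ + 2
  sum = m+[n∸m]≡n (<⇒≤ h<ρ+2)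

module Cases (g k n : ℕ) (k≡ : k ≡ 2 * suc g ⊎ k ≡ 1 + 2 * suc g) (2k≤n : 2 * k ≤ n) where

  private
    h : ℕ
    h = suc g

    2h≤k : 2 * h ≤ k
    2h≤k = [ ≤-reflexive ∘ sym , (λ eq → ≤-trans (n≤1+n (2 * h)) (≤-reflexive (sym eq))) ]′ k≡

    k≤1+2h : k ≤ 1 + 2 * h
    k≤1+2h = [ (λ eq → ≤-trans (≤-reflexive eq) (n≤1+n (2 * h))) , ≤-reflexive ]′ k≡

    k≤n : k ≤ n
    k≤n = ≤-trans (m≤m+n k (k + 0)) 2k≤n

    4h≤n : 2 * (2 * h) ≤ n
    4h≤n = ≤-trans (*-monoʳ-≤ 2 2h≤k) 2k≤n

    0<n : 0 < n
    0<n = ≤-trans (s≤s z≤n) 4h≤n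

    instance
      n≢0 : NonZero n
      n≢0 = >-nonZero 0<n

    open Wheel {n} {k} 0<n k≤n

    fit : ∀ {b} (B : Block k h) Bs → totalSize (B ∷ Bs) ≡ n → totalCost (B ∷ Bs) ≡ b → γmd≤ n k b
    fit B Bs size≡ refl = blocks⇒γmd≤ B Bs size≡

    module Std (a s : ℕ) (h≤a : h ≤ a) (0<s : 0 < s) (s≤h : s ≤ h) =
      Standard k h a s 0<s s≤h 2h≤k (≤-trans k≤1+2h (s≤s (*-monoʳ-≤ 2 h≤a)))

    module F = Std h h ≤-refl z<s ≤-refl

    full : ℕ → List (Block k h)
    full q = replicate q F.block

    size-full : ∀ q → totalSize (full q) ≡ q * (1 + 2 * h + 2 * h)
    size-full q = totalSize-replicate q F.block

    cost-full : ∀ q → totalCost (full q) ≡ q * (1 + 2 * h + h)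
    cost-full q = trans (totalCost-replicate q F.block) (cong (q *_) F.block-cost)

  -- Lengthening the alternating part of one block adds columns at one element each, which is the
  -- price the bound sets for an even remainder.
  evenRemainder : ∀ m ρ → n ≡ 2 * ρ + m * suc (4 * h) → γmd≤ n k ((3 * h + 1) * m + 2 * ρ)
  evenRemainder zero ρ n≡ = subst (γmd≤ n k) (trans n≡ (eq h ρ)) allSpokes
    where eq : ∀ h ρ → 2 * ρ + 0 ≡ (3 * h + 1) * 0 + 2 * ρ
          eq = solve-∀
  evenRemainder (suc m) ρ n≡ =
    fit W.block (full m)
      (trans (cong (W.ℓ +_) (size-full m)) (trans (size-eq h m ρ) (sym n≡)))
      (trans (cong₂ _+_ W.block-cost (cost-full m)) (cost-eq h m ρ))
    where
    module W = Std (h + ρ) h (m≤m+n h ρ) z<s ≤-refl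
    size-eq : ∀ h m ρ → 1 + 2 * (h + ρ) + 2 * h + m * (1 + 2 * h + 2 * h) ≡ 2 * ρ + suc m * suc (4 * h)
    size-eq = solve-∀
    cost-eq : ∀ h m ρ → 1 + 2 * (h + ρ) + h + m * (1 + 2 * h + h) ≡ (3 * h + 1) * suc m + 2 * ρ
    cost-eq = solve-∀

  oddRemainder : ∀ m ρ → ρ < 2 * h → n ≡ 1 + 2 * ρ + m * suc (4 * h) →
                 γmd≤ n k ((3 * h + 1) * m + h + suc ρ)
  oddRemainder zero ρ ρ< n≡ = contradiction impossible (even≢odd (2 * h) ρ)
    where
    -- Without a full block n is 1 + 2ρ, at most 4h, while 2k ≤ n gives 4h ≤ n; so an odd number
    -- would equal an even one.
    impossible : 2 * (2 * h) ≡ 1 + 2 * ρ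
    impossible = ≤-antisym (≤-trans 4h≤n (≤-reflexive (trans n≡ (+-identityʳ _))))
                   (≤-trans (n≤1+n _) (≤-trans (≤-reflexive (eq ρ)) (*-monoʳ-≤ 2 ρ<)))
      where eq : ∀ ρ → suc (1 + 2 * ρ) ≡ 2 * suc ρ
            eq = solve-∀
  -- Here n = T + 1 = 4h + 2 coincides with the bound.
  oddRemainder (suc zero) zero _ n≡ = subst (γmd≤ n k) (trans n≡ (eq h)) allSpokes
    where eq : ∀ h → 1 + 2 * 0 + 1 * suc (4 * h) ≡ (3 * h + 1) * 1 + h + 1
          eq = solve-∀
  oddRemainder (suc (suc m)) zero _ n≡ =
    fit W.block (full m)
      (trans (cong (W.ℓ +_) (size-full m)) (trans (size-eq h m) (sym n≡)))
      (trans (cong₂ _+_ W.block-cost (cost-full m)) (cost-eq h m))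
    where
    -- Solves 1 + 2a + 2h = 2T + 1 = 8h + 3 for a.
    module W = Std (h + (2 * h + 1)) h (m≤m+n h _) z<s ≤-refl
    size-eq : ∀ h m → 1 + 2 * (h + (2 * h + 1)) + 2 * h + m * (1 + 2 * h + 2 * h) ≡
                      1 + 2 * 0 + suc (suc m) * suc (4 * h)
    size-eq = solve-∀
    cost-eq : ∀ h m → 1 + 2 * (h + (2 * h + 1)) + h + m * (1 + 2 * h + h) ≡
                      (3 * h + 1) * suc (suc m) + h + 1
    cost-eq = solve-∀
  oddRemainder (suc m) (suc zero) _ n≡ with blockPlusThree g k k≡
  ... | B , size≡ , cost≡ =
    fit B (full m)
      (trans (cong₂ _+_ size≡ (size-full m)) (trans (size-eq h m) (sym n≡)))
      (trans (cong₂ _+_ cost≡ (cost-full m)) (cost-eq h m))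
    where
    size-eq : ∀ h m → 4 * h + 4 + m * (1 + 2 * h + 2 * h) ≡ 1 + 2 * 1 + suc m * suc (4 * h)
    size-eq = solve-∀
    cost-eq : ∀ h m → 4 * h + 3 + m * (1 + 2 * h + h) ≡ (3 * h + 1) * suc m + h + 2
    cost-eq = solve-∀
  oddRemainder (suc m) (suc (suc ρ)) ρ< n≡ with splitSum h ρ (subst (_< 2 * h) (+-comm 2 ρ) ρ<)
  ... | a , b , 0<a , a≤h , 0<b , b≤h , a+b≡ =
    fit A.block (B.block ∷ full m)
      (trans (cong (λ z → A.ℓ + (B.ℓ + z)) (size-full m))
        (trans (size-eq h m a b) (trans (cong (λ z → 1 + 2 * z + suc m * suc (4 * h)) sum) (sym n≡))))
      (trans (cong₂ _+_ A.block-cost (cong₂ _+_ B.block-cost (cost-full m)))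
        (trans (cost-eq h m a b) (cong (λ z → (3 * h + 1) * suc m + h + suc z) sum)))
    where
    sum : a + b ≡ suc (suc ρ)
    sum = trans a+b≡ (+-comm ρ 2)
    -- The two alternating parts fill 4h + 2 = T + 1 columns; the other 2(a + b) are rim pairs.
    module A = Std h a ≤-refl 0<a a≤h
    module B = Std h b ≤-refl 0<b b≤h
    size-eq : ∀ h m a b → 1 + 2 * h + 2 * a + (1 + 2 * h + 2 * b + m * (1 + 2 * h + 2 * h)) ≡
                          1 + 2 * (a + b) + suc m * suc (4 * h)
    size-eq = solve-∀
    cost-eq : ∀ h m a b → 1 + 2 * h + a + (1 + 2 * h + b + m * (1 + 2 * h + h)) ≡
                          (3 * h + 1) * suc m + h + suc (a + b)
    cost-eq = solve-∀

-- Evaluating `bound` by parity, and the theorem.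

half-cases : ∀ k → k ≡ 2 * (k / 2) ⊎ k ≡ 1 + 2 * (k / 2)
half-cases k with k % 2 | m%n<n k 2 | m≡m%n+[m/n]*n k 2
... | 0 | _ | eq = inj₁ (trans eq (*-comm (k / 2) 2))
... | 1 | _ | eq = inj₂ (trans eq (cong suc (*-comm (k / 2) 2)))
... | suc (suc _) | s<s (s<s ()) | _

bound-even : ∀ n k ρ → n % suc (4 * (k / 2)) ≡ 2 * ρ →
  bound n k ≡ (3 * (k / 2) + 1) * (n / suc (4 * (k / 2))) + 2 * ρ
bound-even n k ρ eq =
  trans (unfold (trans (cong (_% 2) (trans eq (*-comm 2 ρ))) (m*n%n≡0 ρ 2)))
    (cong ((3 * (k / 2) + 1) * (n / suc (4 * (k / 2))) +_) eq)
  where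
  unfold : n % suc (4 * (k / 2)) % 2 ≡ 0 →
    bound n k ≡ (3 * (k / 2) + 1) * (n / suc (4 * (k / 2))) + n % suc (4 * (k / 2))
  unfold r%2≡0 rewrite r%2≡0 = refl

bound-odd : ∀ n k ρ → n % suc (4 * (k / 2)) ≡ 1 + 2 * ρ →
  bound n k ≡ (3 * (k / 2) + 1) * (n / suc (4 * (k / 2))) + k / 2 + suc ρ
bound-odd n k ρ eq =
  trans (unfold (trans (cong (_% 2) (trans eq (cong suc (*-comm 2 ρ)))) ([m+kn]%n≡m%n 1 ρ 2)))
    (cong ((3 * (k / 2) + 1) * (n / suc (4 * (k / 2))) + k / 2 +_)
      (trans (cong (λ r → (r + 1) / 2) eq) (trans (cong (_/ 2) (double ρ)) (m*n/n≡m (suc ρ) 2))))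
  where
  double : ∀ ρ → 1 + 2 * ρ + 1 ≡ suc ρ * 2
  double = solve-∀
  unfold : n % suc (4 * (k / 2)) % 2 ≡ 1 →
    bound n k ≡ (3 * (k / 2) + 1) * (n / suc (4 * (k / 2))) + k / 2
                + (n % suc (4 * (k / 2)) + 1) / 2
  unfold r%2≡1 rewrite r%2≡1 = refl

theorem3 : (k n : ℕ) → 3 ≤ k → 2 * k ≤ n → γmd≤ n k (bound n k)
theorem3 k n 3≤k 2k≤n = byHalf (k / 2) refl (half-cases k)
  where
  byHalf : ∀ h → k / 2 ≡ h → k ≡ 2 * (k / 2) ⊎ k ≡ 1 + 2 * (k / 2) → γmd≤ n k (bound n k)
  -- A zero half would make k at most 1, against 3 ≤ k.
  byHalf zero h≡ (inj₁ eq) with () ← subst (3 ≤_) (trans eq (cong (2 *_) h≡)) 3≤k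
  byHalf zero h≡ (inj₂ eq) with s≤s () ← subst (3 ≤_) (trans eq (cong (λ h → 1 + 2 * h) h≡)) 3≤k
  byHalf (suc g) h≡ k≡ = byParity (parity (n % T)) refl
    where
    T = suc (4 * (k / 2))
    open Cases g k n (subst (λ h → k ≡ 2 * h ⊎ k ≡ 1 + 2 * h) h≡ k≡) 2k≤n
    n≡ : ∀ {r} → n % T ≡ r → n ≡ r + n / T * suc (4 * suc g)
    n≡ r≡ = trans (m≡m%n+[m/n]*n n T) (cong₂ (λ r h → r + n / T * suc (4 * h)) r≡ h≡)
    byParity : ∀ {r} → Parity r → n % T ≡ r → γmd≤ n k (bound n k)
    byParity (even ρ) r≡ = subst (γmd≤ n k)
      (sym (trans (bound-even n k ρ r≡) (cong (λ h → (3 * h + 1) * (n / T) + 2 * ρ) h≡)))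
      (evenRemainder (n / T) ρ (n≡ r≡))
    byParity (odd ρ) r≡ = subst (γmd≤ n k)
      (sym (trans (bound-odd n k ρ r≡) (cong (λ h → (3 * h + 1) * (n / T) + h + suc ρ) h≡)))
      (oddRemainder (n / T) ρ ρ< (n≡ r≡))
      where
      double : ∀ h → 4 * h ≡ 2 * (2 * h)
      double = solve-∀
      ρ< : ρ < 2 * suc g
      ρ< = half-< {ρ} (subst (2 * ρ <_) (double (suc g))
             (s≤s⁻¹ (subst₂ _<_ r≡ (cong (λ h → suc (4 * h)) h≡) (m%n<n n T))))
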